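{- Let $\mathsf{U}:(\mathbb{N}\to\mathbb{N})^k\to\mathbb{N}$ be a typed update procedure of ordinal $k\in\mathbb{N}$, $k\ge1$ (i.e. a $k$-ary typed update procedure). Then one can constructively define terms $\varepsilon_1,\dots,\varepsilon_k$ of Gödel's system $\mathcal{T}$ such that $\mathsf{U}\varepsilon_1\dots\varepsilon_k=|\varnothing|$.
   Context: Gödel's system $\mathcal{T}$: simply typed $\lambda$-calculus over $\mathbb{N},\mathsf{Bool}$ with products, arrows, $0,\mathsf{S}$, booleans, conditionals and recursors in all types; equality is provable equality. Fix a primitive recursive bijective coding $|\cdot|:\mathbb{N}^3\cup\{\varnothing\}\to\mathbb{N}$. For $k\ge1$, a $k$-ary typed update procedure is a term $\mathsf{U}:(\mathbb{N}\to\mathbb{N})^k\to\mathbb{N}$ of $\mathcal{T}$ such that: (1) for every sequence $f=f_1,\dots,f_k$ of closed terms of type $\mathbb{N}\to\mathbb{N}$, $\mathsf{U}f=|(i,n,m)|$ implies $1\le i\le k$; (2) for all such sequences $f,g$ and all $1\le i\le k$: if $f_j=g_j$ for all $j<i$, $\mathsf{U}f=|(i,n,m)|$, $g_i(n)=m$ and $\mathsf{U}g=|(i,h,l)|$, then $h\neq n$. The terms $\varepsilon_i$ are closed terms of type $\mathbb{N}\to\mathbb{N}$. -}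

module Defs where

open import Data.Nat using (ℕ; zero; suc; _+_; _≤_; _<_)
open import Data.Fin using (Fin; toℕ) renaming (zero to fz; suc to fs)
open import Data.Maybe using (Maybe; just; nothing)
open import Data.Product using (_×_; _,_; Σ)
open import Data.List using (List; []; _∷_)
open import Relation.Binary.PropositionalEquality using (_≡_)
open import Relation.Nullary using (¬_)

infixr 7 _⇒_
infixr 8 _⊗_

data Ty : Set where
  nat  : Ty
  bool : Ty
  _⇒_  : Ty → Ty → Ty
  _⊗_  : Ty → Ty → Ty

Ctx : Set
Ctx = List Ty

data _∋_ : Ctx → Ty → Set where
  here  : ∀ {Γ A} → (A ∷ Γ) ∋ A
  there : ∀ {Γ A B} → Γ ∋ A → (B ∷ Γ) ∋ A

infixl 9 _·_

data Tm (Γ : Ctx) : Ty → Set where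
  var   : ∀ {A} → Γ ∋ A → Tm Γ A
  lam   : ∀ {A B} → Tm (A ∷ Γ) B → Tm Γ (A ⇒ B)
  _·_   : ∀ {A B} → Tm Γ (A ⇒ B) → Tm Γ A → Tm Γ B
  pair  : ∀ {A B} → Tm Γ A → Tm Γ B → Tm Γ (A ⊗ B)
  fst   : ∀ {A B} → Tm Γ (A ⊗ B) → Tm Γ A
  snd   : ∀ {A B} → Tm Γ (A ⊗ B) → Tm Γ B
  zer   : Tm Γ nat
  suc'  : Tm Γ nat → Tm Γ nat
  tt    : Tm Γ bool
  ff    : Tm Γ bool
  if    : ∀ {A} → Tm Γ bool → Tm Γ A → Tm Γ A → Tm Γ A
  rec   : ∀ {A} → Tm Γ A → Tm Γ (nat ⇒ A ⇒ A) → Tm Γ nat → Tm Γ A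

Closed : Ty → Set
Closed = Tm []

Ren : Ctx → Ctx → Set
Ren Γ Δ = ∀ {A} → Γ ∋ A → Δ ∋ A

ext : ∀ {Γ Δ B} → Ren Γ Δ → Ren (B ∷ Γ) (B ∷ Δ)
ext ρ here      = here
ext ρ (there x) = there (ρ x)

rename : ∀ {Γ Δ A} → Ren Γ Δ → Tm Γ A → Tm Δ A
rename ρ (var x)     = var (ρ x)
rename ρ (lam t)     = lam (rename (ext ρ) t)
rename ρ (t · u)     = rename ρ t · rename ρ u
rename ρ (pair t u)  = pair (rename ρ t) (rename ρ u)
rename ρ (fst t)     = fst (rename ρ t)
rename ρ (snd t)     = snd (rename ρ t)
rename ρ zer         = zer
rename ρ (suc' t)    = suc' (rename ρ t)
rename ρ tt          = tt
rename ρ ff          = ff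
rename ρ (if b t u)  = if (rename ρ b) (rename ρ t) (rename ρ u)
rename ρ (rec z s n) = rec (rename ρ z) (rename ρ s) (rename ρ n)

Sub : Ctx → Ctx → Set
Sub Γ Δ = ∀ {A} → Γ ∋ A → Tm Δ A

exts : ∀ {Γ Δ B} → Sub Γ Δ → Sub (B ∷ Γ) (B ∷ Δ)
exts σ here      = var here
exts σ (there x) = rename there (σ x)

subst : ∀ {Γ Δ A} → Sub Γ Δ → Tm Γ A → Tm Δ A
subst σ (var x)     = σ x
subst σ (lam t)     = lam (subst (exts σ) t)
subst σ (t · u)     = subst σ t · subst σ u
subst σ (pair t u)  = pair (subst σ t) (subst σ u)
subst σ (fst t)     = fst (subst σ t)
subst σ (snd t)     = snd (subst σ t)
subst σ zer         = zer
subst σ (suc' t)    = suc' (subst σ t)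
subst σ tt          = tt
subst σ ff          = ff
subst σ (if b t u)  = if (subst σ b) (subst σ t) (subst σ u)
subst σ (rec z s n) = rec (subst σ z) (subst σ s) (subst σ n)

sub0 : ∀ {Γ A} → Tm Γ A → Sub (A ∷ Γ) Γ
sub0 u here      = u
sub0 u (there x) = var x

_[_] : ∀ {Γ A B} → Tm (A ∷ Γ) B → Tm Γ A → Tm Γ B
t [ u ] = subst (sub0 u) t

-- Provable equality of system T: the least congruence (equivalence,
-- compatible with all term formers, including under λ) containing the
-- β-rules for λ, products, conditionals and recursors.

infix 4 _≈_

data _≈_ {Γ : Ctx} : ∀ {A} → Tm Γ A → Tm Γ A → Set where
  ≈refl  : ∀ {A} {t : Tm Γ A} → t ≈ t
  ≈sym   : ∀ {A} {t u : Tm Γ A} → t ≈ u → u ≈ t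
  ≈trans : ∀ {A} {t u v : Tm Γ A} → t ≈ u → u ≈ v → t ≈ v
  lam-cong  : ∀ {A B} {t t' : Tm (A ∷ Γ) B} → t ≈ t' → lam t ≈ lam t'
  app-cong  : ∀ {A B} {t t' : Tm Γ (A ⇒ B)} {u u' : Tm Γ A} →
              t ≈ t' → u ≈ u' → t · u ≈ t' · u'
  pair-cong : ∀ {A B} {t t' : Tm Γ A} {u u' : Tm Γ B} →
              t ≈ t' → u ≈ u' → pair t u ≈ pair t' u'
  fst-cong  : ∀ {A B} {t t' : Tm Γ (A ⊗ B)} → t ≈ t' → fst t ≈ fst t'
  snd-cong  : ∀ {A B} {t t' : Tm Γ (A ⊗ B)} → t ≈ t' → snd t ≈ snd t'
  suc-cong  : ∀ {t t' : Tm Γ nat} → t ≈ t' → suc' t ≈ suc' t'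
  if-cong   : ∀ {A} {b b' : Tm Γ bool} {t t' u u' : Tm Γ A} →
              b ≈ b' → t ≈ t' → u ≈ u' → if b t u ≈ if b' t' u'
  rec-cong  : ∀ {A} {z z' : Tm Γ A} {s s' : Tm Γ (nat ⇒ A ⇒ A)} {n n' : Tm Γ nat} →
              z ≈ z' → s ≈ s' → n ≈ n' → rec z s n ≈ rec z' s' n'
  β-lam    : ∀ {A B} (t : Tm (A ∷ Γ) B) (u : Tm Γ A) → lam t · u ≈ t [ u ]
  β-fst    : ∀ {A B} (t : Tm Γ A) (u : Tm Γ B) → fst (pair t u) ≈ t
  β-snd    : ∀ {A B} (t : Tm Γ A) (u : Tm Γ B) → snd (pair t u) ≈ u
  β-if-tt  : ∀ {A} (t u : Tm Γ A) → if tt t u ≈ t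
  β-if-ff  : ∀ {A} (t u : Tm Γ A) → if ff t u ≈ u
  β-rec-0  : ∀ {A} (z : Tm Γ A) (s : Tm Γ (nat ⇒ A ⇒ A)) → rec z s zer ≈ z
  β-rec-S  : ∀ {A} (z : Tm Γ A) (s : Tm Γ (nat ⇒ A ⇒ A)) (n : Tm Γ nat) →
             rec z s (suc' n) ≈ s · n · rec z s n

num : ∀ {Γ} → ℕ → Tm Γ nat
num zero    = zer
num (suc n) = suc' (num n)

-- A fixed primitive recursive bijective coding |·| : ℕ³ ∪ {∅} → ℕ
--   |∅| = 0,   |(i,n,m)| = 1 + ⟨i , ⟨n , m⟩⟩   (Cantor pairing ⟨a,b⟩)

tri : ℕ → ℕ
tri zero    = zero
tri (suc n) = suc n + tri n

cantor : ℕ → ℕ → ℕ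
cantor a b = tri (a + b) + b

code : Maybe (ℕ × ℕ × ℕ) → ℕ
code nothing            = zero
code (just (i , n , m)) = suc (cantor i (cantor n m))

-- k-ary functionals (ℕ→ℕ)^k → ℕ, in curried form, and application

Arr : ℕ → Ty → Ty
Arr zero    B = B
Arr (suc k) B = (nat ⇒ nat) ⇒ Arr k B

applyAll : ∀ {Γ B} k → Tm Γ (Arr k B) → (Fin k → Tm Γ (nat ⇒ nat)) → Tm Γ B
applyAll zero    t f = t
applyAll (suc k) t f = applyAll k (t · f fz) (λ j → f (fs j))

-- k-ary typed update procedure.
-- Sequences f = f₁,…,f_k are indexed by Fin k; the paper's index i ∈ {1..k}
-- corresponds to i : Fin k via 1 + toℕ i.

record IsTypedUpdateProcedure (k : ℕ) (U : Closed (Arr k nat)) : Set where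
  field
    cond1 : ∀ (f : Fin k → Closed (nat ⇒ nat)) (i n m : ℕ) →
            applyAll k U f ≈ num (code (just (i , n , m))) →
            1 ≤ i × i ≤ k
    cond2 : ∀ (f g : Fin k → Closed (nat ⇒ nat)) (i : Fin k) (n m h l : ℕ) →
            (∀ (j : Fin k) → toℕ j < toℕ i → f j ≈ g j) →
            applyAll k U f ≈ num (code (just (suc (toℕ i) , n , m))) →
            g i · num n ≈ num m →
            applyAll k U g ≈ num (code (just (suc (toℕ i) , h , l))) →
            ¬ (h ≡ n)

-- Interpreting U in a dialogue model of system T, where the k arguments are
-- generic functions, turns U into a well-founded tree of queries f_i(n) whose
-- leaves are codes; a logical relation shows that U applied to the terms of any
-- finite maps β provably equals the leaf reached when the queries are answered
-- by β. So it suffices to find finite maps under which the tree reaches |∅|.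
-- For one function, walk down the tree with a current map, remembering the
-- points queried on the current path. When a leaf demands the update f(n) := m,
-- n was queried on the path (otherwise condition (2) fails for the map updated
-- at n), so we backtrack to that query and re-explore its subtree with the
-- answer m; by condition (2) the subtree never demands an update of n again, so
-- the search is a structural recursion on the tree. For k functions we induct
-- on k: f₁, whose updates have no precondition, is learnt outermost, and
-- f₂ … f_k are learnt with the map of f₁ as part of the environment.
-- Condition (1) excludes leaves coding an out-of-range index.

module Submission where

open import Defs
open import Data.Bool using (Bool; true; false; if_then_else_)
open import Data.Empty using (⊥; ⊥-elim)
open import Data.Fin using (Fin; toℕ; zero; suc; fromℕ<)
open import Data.Fin.Properties using (toℕ-fromℕ<)
open import Data.List using (List; []; _∷_)
open import Data.List.Membership.Propositional using (_∈_; _∉_)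
open import Data.List.Relation.Unary.Any using (here; there)
open import Data.Maybe using (just; nothing)
open import Data.Nat using (ℕ; zero; suc; _+_; _≤_; _<_; s≤s; _≡ᵇ_; _≟_)
open import Data.Nat.Properties using (≡ᵇ⇒≡; ≡⇒≡ᵇ; _<?_; +-suc; +-identityʳ; +-comm)
open import Data.List.Membership.DecPropositional _≟_ using (_∈?_)
open import Data.Product using (Σ; ∃-syntax; _×_; _,_; proj₁; proj₂; uncurry)
open import Data.Sum using (_⊎_; inj₁; inj₂; [_,_])
open import Data.Unit using (⊤)
open import Data.Vec.Functional as Vector using ()
open import Function using (id; _∘_; _∘′_)
open import Relation.Binary.PropositionalEquality
  using (_≡_; _≢_; refl; sym; trans; cong; cong₂; module ≡-Reasoning)
  renaming (subst to substEq)
open import Relation.Nullary using (¬_; yes; no)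

data Dialogue (Q X : Set) : Set where
  leaf : X → Dialogue Q X
  ask  : Q → (ℕ → Dialogue Q X) → Dialogue Q X

eval : ∀ {Q X} → (Q → ℕ) → Dialogue Q X → X
eval α (leaf x)  = x
eval α (ask q k) = eval α (k (α q))

infixl 1 _>>=_

_>>=_ : ∀ {Q X Y} → Dialogue Q X → (X → Dialogue Q Y) → Dialogue Q Y
leaf x  >>= h = h x
ask q k >>= h = ask q (λ v → k v >>= h)

eval->>= : ∀ {Q X Y} (α : Q → ℕ) (d : Dialogue Q X) (h : X → Dialogue Q Y) →
           eval α (d >>= h) ≡ eval α (h (eval α d))
eval->>= α (leaf x)  h = refl
eval->>= α (ask q k) h = eval->>= α (k (α q)) h

relabel : ∀ {Q Q′ X Y} → (Q → Q′) → (X → Y) → Dialogue Q X → Dialogue Q′ Y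
relabel r c (leaf x)  = leaf (c x)
relabel r c (ask q k) = ask (r q) (λ v → relabel r c (k v))

eval-relabel : ∀ {Q Q′ X Y} {r : Q → Q′} {c : X → Y} {α : Q → ℕ} {α′ : Q′ → ℕ} →
               (∀ q → α′ (r q) ≡ α q) → (d : Dialogue Q X) →
               eval α′ (relabel r c d) ≡ c (eval α d)
eval-relabel e (leaf x)              = refl
eval-relabel {α = α} e (ask q k) rewrite e q = eval-relabel e (k (α q))

FinMap : Set
FinMap = List (ℕ × ℕ)

lookup : FinMap → ℕ → ℕ
lookup []            x = 0
lookup ((n , m) ∷ f) x = if x ≡ᵇ n then m else lookup f x

insert : ℕ → ℕ → FinMap → FinMap
insert x m f = (x , m) ∷ f

lookup-insert-same : ∀ x m f → lookup (insert x m f) x ≡ m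
lookup-insert-same x m f with x ≡ᵇ x | ≡⇒≡ᵇ x x refl
... | true | _ = refl

lookup-insert-other : ∀ {x y} m f → y ≢ x → lookup (insert x m f) y ≡ lookup f y
lookup-insert-other {x} {y} m f y≢x with y ≡ᵇ x | ≡ᵇ⇒≡ y x
... | false | _    = refl
... | true  | y≡x  = ⊥-elim (y≢x (y≡x _))

record Agree (P : List ℕ) (f g : FinMap) : Set where
  constructor agreeing
  field agree : ∀ {p} → p ∈ P → lookup f p ≡ lookup g p

open Agree

agree-refl : ∀ {P f} → Agree P f f
agree-refl = agreeing λ _ → refl

agree-trans : ∀ {P f g h} → Agree P f g → Agree P g h → Agree P f h
agree-trans fg gh = agreeing λ p∈ → trans (agree fg p∈) (agree gh p∈)

agree-tail : ∀ {x P f g} → Agree (x ∷ P) f g → Agree P f g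
agree-tail fg = agreeing λ p∈ → agree fg (there p∈)

agree-insert : ∀ {x P} m f → x ∉ P → Agree P f (insert x m f)
agree-insert m f x∉P =
  agreeing λ p∈ → sym (lookup-insert-other m f (λ { refl → x∉P p∈ }))

record Environment : Set₁ where
  field
    Query  : Set
    Oracle : Set
    answer : Oracle → Query → ℕ

open Environment

withFunction : Environment → Environment
withFunction S = record
  { Query  = Query S ⊎ ℕ
  ; Oracle = Oracle S × FinMap
  ; answer = λ (o , f) → [ answer S o , lookup f ]
  }

module OneFunction (S : Environment) where

  answerWith : Oracle S → FinMap → Query S ⊎ ℕ → ℕ
  answerWith o f = answer (withFunction S) (o , f)

  module _ {X : Set} where

    data Run : Set where
      halt      : X → Run
      backtrack : ℕ → ℕ → FinMap → Run

    resume : (ℕ → FinMap → Dialogue (Query S) Run) → List ℕ → Run → Dialogue (Query S) Run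
    resume retry P (halt x) = leaf (halt x)
    resume retry P (backtrack p m f) with p ∈? P
    ... | yes _ = leaf (backtrack p m f)
    ... | no  _ = retry m f

    -- P lists the points queried on the current path. An update demanded of the
    -- point queried at this node is carried out here by re-running the subtree;
    -- any other update is passed upwards.
    learn : Dialogue (Query S ⊎ ℕ) (X ⊎ (ℕ × ℕ)) → List ℕ → FinMap → Dialogue (Query S) Run
    learn (leaf (inj₁ x))       P f = leaf (halt x)
    learn (leaf (inj₂ (n , m))) P f = leaf (backtrack n m f)
    learn (ask (inj₁ q) k)      P f = ask q (λ v → learn (k v) P f)
    learn (ask (inj₂ x) k)      P f =
      learn (k (lookup f x)) (x ∷ P) f >>= resume (λ m f′ → learn (k m) (x ∷ P) (insert x m f′)) P

    module _ (D : Dialogue (Query S ⊎ ℕ) (X ⊎ (ℕ × ℕ))) where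

      ⟦D⟧ : Oracle S → FinMap → X ⊎ (ℕ × ℕ)
      ⟦D⟧ o f = eval (answerWith o f) D

      IsUpdate : Set
      IsUpdate = ∀ o f g {n m h l} → ⟦D⟧ o f ≡ inj₂ (n , m) → lookup g n ≡ m →
                 ⟦D⟧ o g ≡ inj₂ (h , l) → h ≢ n

      -- x₀ is never returned: no update is passed up past the root.
      conclude : X → Run → Dialogue (Query S) X
      conclude x₀ (halt x)          = leaf x
      conclude x₀ (backtrack _ _ _) = leaf x₀

      learned : X → Dialogue (Query S) X
      learned x₀ = learn D [] [] >>= conclude x₀

      Represents : Oracle S → List ℕ → FinMap → Dialogue (Query S ⊎ ℕ) (X ⊎ (ℕ × ℕ)) → Set
      Represents o P f E = ∀ g → Agree P f g → ⟦D⟧ o g ≡ eval (answerWith o g) E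

      Sound : Oracle S → List ℕ → FinMap → Run → Set
      Sound o P f (halt x)           = ∃[ f′ ] ⟦D⟧ o f′ ≡ inj₁ x
      Sound o P f (backtrack p m f′) = p ∈ P × ⟦D⟧ o f′ ≡ inj₂ (p , m) × Agree P f f′

      represents-ask : ∀ {o P f f′ x m} k → Represents o P f (ask (inj₂ x) k) →
                       Agree P f f′ → lookup f′ x ≡ m → Represents o (x ∷ P) f′ (k m)
      represents-ask {o} k rep f~f′ f′[x]≡m g f′~g =
        trans (rep g (agree-trans f~f′ (agree-tail f′~g)))
              (cong (λ v → eval (answerWith o g) (k v)) (trans (sym (agree f′~g (here refl))) f′[x]≡m))

      module _ (isUpdate : IsUpdate) where

        retry-sound : ∀ {o x P f f′ m} → ⟦D⟧ o f′ ≡ inj₂ (x , m) → Agree P f (insert x m f′) →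
                      ∀ r → Sound o (x ∷ P) (insert x m f′) r → Sound o P f r
        retry-sound e f~f′ (halt x) s = s
        retry-sound {o} {x} {f′ = f′} {m} e f~f′ (backtrack p m′ f″) (here refl , e′ , ag) =
          ⊥-elim (isUpdate o f′ f″ e (trans (sym (agree ag (here refl))) (lookup-insert-same x m f′))
                           e′ refl)
        retry-sound e f~f′ (backtrack p m′ f″) (there p∈P , e′ , ag) =
          p∈P , e′ , agree-trans f~f′ (agree-tail ag)

        resume-sound : ∀ {o x P f retry} →
          (∀ {m f′} → ⟦D⟧ o f′ ≡ inj₂ (x , m) → Agree P f (insert x m f′) →
             Sound o P f (eval (answer S o) (retry m f′))) →
          ∀ r → Sound o (x ∷ P) f r → Sound o P f (eval (answer S o) (resume retry P r))
        resume-sound hyp (halt x) s = s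
        resume-sound {P = P} hyp (backtrack p m f′) (p∈ , e , ag) with p ∈? P
        ... | yes p∈P = p∈P , e , agree-tail ag
        ... | no p∉P with p∈
        ...   | here refl = hyp e (agree-trans (agree-tail ag) (agree-insert m f′ p∉P))
        ...   | there p∈P = ⊥-elim (p∉P p∈P)

        learn-sound : ∀ o E P f → Represents o P f E → Sound o P f (eval (answer S o) (learn E P f))
        learn-sound o (leaf (inj₁ x)) P f rep = f , rep f agree-refl
        learn-sound o (leaf (inj₂ (n , m))) P f rep with n ∈? P
        ... | yes n∈P = n∈P , rep f agree-refl , agree-refl
        ... | no n∉P  = ⊥-elim (isUpdate o f (insert n m f) (rep f agree-refl) (lookup-insert-same n m f)
                                        (rep (insert n m f) (agree-insert m f n∉P)) refl)
        learn-sound o (ask (inj₁ q) k) P f rep = learn-sound o (k (answer S o q)) P f rep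
        learn-sound o (ask (inj₂ x) k) P f rep
          rewrite eval->>= (answer S o) (learn (k (lookup f x)) (x ∷ P) f)
                    (resume (λ m f′ → learn (k m) (x ∷ P) (insert x m f′)) P) =
          resume-sound
            (λ {m} {f′} e f~f′ → retry-sound e f~f′ _
               (learn-sound o (k m) (x ∷ P) (insert x m f′)
                  (represents-ask k rep f~f′ (lookup-insert-same x m f′))))
            _ (learn-sound o (k (lookup f x)) (x ∷ P) f (represents-ask k rep agree-refl refl))

        learned-correct : ∀ x₀ o → ∃[ f ] ⟦D⟧ o f ≡ inj₁ (eval (answer S o) (learned x₀))
        learned-correct x₀ o rewrite eval->>= (answer S o) (learn D [] []) (conclude x₀) =
          conclusion _ (learn-sound o D [] [] (λ _ _ → refl))
          where
          conclusion : ∀ r → Sound o [] [] r →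
                       ∃[ f ] ⟦D⟧ o f ≡ inj₁ (eval (answer S o) (conclude x₀ r))
          conclusion (halt x) s = s
          conclusion (backtrack _ _ _) (() , _)

data Outcome (X : Set) (k : ℕ) : Set where
  exit   : X → Outcome X k
  update : Fin k → ℕ → ℕ → Outcome X k

answerK : (S : Environment) {k : ℕ} → Oracle S → (Fin k → FinMap) → Query S ⊎ (Fin k × ℕ) → ℕ
answerK S o β = [ answer S o , uncurry (λ i → lookup (β i)) ]

IsUpdateTree : (S : Environment) {X : Set} (k : ℕ) →
               Dialogue (Query S ⊎ (Fin k × ℕ)) (Outcome X k) → Set
IsUpdateTree S k D = ∀ o β β′ i {n m h l} → (∀ j → toℕ j < toℕ i → β j ≡ β′ j) →
  eval (answerK S o β) D ≡ update i n m → lookup (β′ i) n ≡ m →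
  eval (answerK S o β′) D ≡ update i h l → h ≢ n

Resolves : (S : Environment) {X : Set} {k : ℕ} → Dialogue (Query S) X →
           Dialogue (Query S ⊎ (Fin k × ℕ)) (Outcome X k) → Set
Resolves S D′ D = ∀ o → ∃[ β ] eval (answerK S o β) D ≡ exit (eval (answer S o) D′)

module Nullary (S : Environment) {X : Set} where

  exitValue : Outcome X 0 → X
  exitValue (exit x) = x

  withoutFunctions : Dialogue (Query S ⊎ (Fin 0 × ℕ)) (Outcome X 0) → Dialogue (Query S) X
  withoutFunctions = relabel [ id , (λ ()) ∘ proj₁ ] exitValue

  resolves-withoutFunctions : ∀ D → Resolves S (withoutFunctions D) D
  resolves-withoutFunctions D o =
    (λ ()) , sym (trans (cong exit (eval-relabel same-answer D)) (exit-exitValue _))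
    where
    same-answer : ∀ q → answer S o ([ id , (λ ()) ∘ proj₁ ] q) ≡ answerK S o (λ ()) q
    same-answer (inj₁ q)       = refl
    same-answer (inj₂ (() , _))
    exit-exitValue : ∀ r → exit (exitValue r) ≡ r
    exit-exitValue (exit x) = refl

module Peel (S : Environment) {X : Set} {k : ℕ} where

  S′ : Environment
  S′ = withFunction S

  peelQuery : Query S ⊎ (Fin (suc k) × ℕ) → Query S′ ⊎ (Fin k × ℕ)
  peelQuery (inj₁ q)           = inj₁ (inj₁ q)
  peelQuery (inj₂ (zero , x))  = inj₁ (inj₂ x)
  peelQuery (inj₂ (suc i , x)) = inj₂ (i , x)

  peelOutcome : Outcome X (suc k) → Outcome (X ⊎ (ℕ × ℕ)) k
  peelOutcome (exit x)             = exit (inj₁ x)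
  peelOutcome (update zero n m)    = exit (inj₂ (n , m))
  peelOutcome (update (suc i) n m) = update i n m

  unpeel : Outcome (X ⊎ (ℕ × ℕ)) k → Outcome X (suc k)
  unpeel (exit (inj₁ x))       = exit x
  unpeel (exit (inj₂ (n , m))) = update zero n m
  unpeel (update i n m)        = update (suc i) n m

  unpeel-peelOutcome : ∀ r → unpeel (peelOutcome r) ≡ r
  unpeel-peelOutcome (exit x)             = refl
  unpeel-peelOutcome (update zero n m)    = refl
  unpeel-peelOutcome (update (suc i) n m) = refl

  peeled : Dialogue (Query S ⊎ (Fin (suc k) × ℕ)) (Outcome X (suc k)) →
           Dialogue (Query S′ ⊎ (Fin k × ℕ)) (Outcome (X ⊎ (ℕ × ℕ)) k)
  peeled = relabel peelQuery peelOutcome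

  eval-peeled : ∀ D o f β {s} → eval (answerK S′ (o , f) β) (peeled D) ≡ s →
                eval (answerK S o (f Vector.∷ β)) D ≡ unpeel s
  eval-peeled D o f β e =
    trans (sym (unpeel-peelOutcome _)) (cong unpeel (trans (sym (eval-relabel same-answer D)) e))
    where
    same-answer : ∀ q → answerK S′ (o , f) β (peelQuery q) ≡ answerK S o (f Vector.∷ β) q
    same-answer (inj₁ q)           = refl
    same-answer (inj₂ (zero , x))  = refl
    same-answer (inj₂ (suc i , x)) = refl

  peeled-isUpdate : ∀ D → IsUpdateTree S (suc k) D → IsUpdateTree S′ k (peeled D)
  peeled-isUpdate D isU (o , f) β β′ i agree e₁ β′[i][n]≡m e₂ =
    isU o (f Vector.∷ β) (f Vector.∷ β′) (suc i) agree′
        (eval-peeled D o f β e₁) β′[i][n]≡m (eval-peeled D o f β′ e₂)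
    where
    agree′ : ∀ j → toℕ j < toℕ (suc i) → (f Vector.∷ β) j ≡ (f Vector.∷ β′) j
    agree′ zero    _         = refl
    agree′ (suc j) (s≤s j<i) = agree j j<i

  module _ (D : Dialogue (Query S ⊎ (Fin (suc k) × ℕ)) (Outcome X (suc k)))
           (D₂ : Dialogue (Query S′) (X ⊎ (ℕ × ℕ))) (D₂-resolves : Resolves S′ D₂ (peeled D)) where

    open OneFunction S using (answerWith; IsUpdate; learned; learned-correct)

    resolves-outer : ∀ o f {s} → eval (answerWith o f) D₂ ≡ s →
                     ∃[ β ] eval (answerK S o (f Vector.∷ β)) D ≡ unpeel (exit s)
    resolves-outer o f e with D₂-resolves (o , f)
    ... | β , e′ = β , eval-peeled D o f β (trans e′ (cong exit e))

    outer-isUpdate : IsUpdateTree S (suc k) D → IsUpdate D₂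
    outer-isUpdate isU o f g e₁ g[n]≡m e₂ with resolves-outer o f e₁ | resolves-outer o g e₂
    ... | β , u₁ | β′ , u₂ = isU o (f Vector.∷ β) (g Vector.∷ β′) zero (λ _ ()) u₁ g[n]≡m u₂

    resolves-learned : IsUpdate D₂ → ∀ x₀ → Resolves S (learned D₂ x₀) D
    resolves-learned isU₂ x₀ o with learned-correct D₂ isU₂ x₀ o
    ... | f , e with resolves-outer o f e
    ...   | β , e′ = f Vector.∷ β , e′

solve : ∀ k S {X} → X → (D : Dialogue (Query S ⊎ (Fin k × ℕ)) (Outcome X k)) →
        IsUpdateTree S k D → Σ (Dialogue (Query S) X) λ D′ → Resolves S D′ D
solve zero    S x₀ D isU = Nullary.withoutFunctions S D , Nullary.resolves-withoutFunctions S D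
solve (suc k) S x₀ D isU =
  let D₂ , D₂-resolves = solve k (withFunction S) (inj₁ x₀) (peeled D) (peeled-isUpdate D isU)
  in  learned D₂ x₀ , resolves-learned D D₂ D₂-resolves (outer-isUpdate D D₂ D₂-resolves isU) x₀
  where
  open Peel S
  open OneFunction S using (learned)

cong₃ : ∀ {A B C D : Set} (f : A → B → C → D) {a a′ b b′ c c′} →
        a ≡ a′ → b ≡ b′ → c ≡ c′ → f a b c ≡ f a′ b′ c′
cong₃ f refl refl refl = refl

≡⇒≈ : ∀ {Γ A} {t u : Tm Γ A} → t ≡ u → t ≈ u
≡⇒≈ refl = ≈refl

infix 4 _≗ˢ_

_≗ˢ_ : ∀ {Γ Δ} → Sub Γ Δ → Sub Γ Δ → Set
σ ≗ˢ τ = ∀ {A} (x : _ ∋ A) → σ x ≡ τ x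

exts-cong : ∀ {Γ Δ B} {σ τ : Sub Γ Δ} → σ ≗ˢ τ → exts {B = B} σ ≗ˢ exts τ
exts-cong e here      = refl
exts-cong e (there x) = cong (rename there) (e x)

subst-cong : ∀ {Γ Δ A} {σ τ : Sub Γ Δ} → σ ≗ˢ τ → (t : Tm Γ A) → subst σ t ≡ subst τ t
subst-cong e (var x)     = e x
subst-cong e (lam t)     = cong lam (subst-cong (exts-cong e) t)
subst-cong e (t · u)     = cong₂ _·_ (subst-cong e t) (subst-cong e u)
subst-cong e (pair t u)  = cong₂ pair (subst-cong e t) (subst-cong e u)
subst-cong e (fst t)     = cong fst (subst-cong e t)
subst-cong e (snd t)     = cong snd (subst-cong e t)
subst-cong e zer         = refl
subst-cong e (suc' t)    = cong suc' (subst-cong e t)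
subst-cong e tt          = refl
subst-cong e ff          = refl
subst-cong e (if b t u)  = cong₃ if (subst-cong e b) (subst-cong e t) (subst-cong e u)
subst-cong e (rec z s n) = cong₃ rec (subst-cong e z) (subst-cong e s) (subst-cong e n)

rename-as-subst : ∀ {Γ Δ A} (ρ : Ren Γ Δ) (t : Tm Γ A) → rename ρ t ≡ subst (var ∘ ρ) t
rename-as-subst ρ (var x)     = refl
rename-as-subst ρ (lam t)     =
  cong lam (trans (rename-as-subst (ext ρ) t) (subst-cong (λ { here → refl ; (there x) → refl }) t))
rename-as-subst ρ (t · u)     = cong₂ _·_ (rename-as-subst ρ t) (rename-as-subst ρ u)
rename-as-subst ρ (pair t u)  = cong₂ pair (rename-as-subst ρ t) (rename-as-subst ρ u)
rename-as-subst ρ (fst t)     = cong fst (rename-as-subst ρ t)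
rename-as-subst ρ (snd t)     = cong snd (rename-as-subst ρ t)
rename-as-subst ρ zer         = refl
rename-as-subst ρ (suc' t)    = cong suc' (rename-as-subst ρ t)
rename-as-subst ρ tt          = refl
rename-as-subst ρ ff          = refl
rename-as-subst ρ (if b t u)  = cong₃ if (rename-as-subst ρ b) (rename-as-subst ρ t) (rename-as-subst ρ u)
rename-as-subst ρ (rec z s n) = cong₃ rec (rename-as-subst ρ z) (rename-as-subst ρ s) (rename-as-subst ρ n)

subst-rename : ∀ {Γ Δ Θ A} (ρ : Ren Γ Δ) (σ : Sub Δ Θ) (t : Tm Γ A) →
               subst σ (rename ρ t) ≡ subst (σ ∘ ρ) t
subst-rename ρ σ (var x)     = refl
subst-rename ρ σ (lam t)     =
  cong lam (trans (subst-rename (ext ρ) (exts σ) t) (subst-cong (λ { here → refl ; (there x) → refl }) t))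
subst-rename ρ σ (t · u)     = cong₂ _·_ (subst-rename ρ σ t) (subst-rename ρ σ u)
subst-rename ρ σ (pair t u)  = cong₂ pair (subst-rename ρ σ t) (subst-rename ρ σ u)
subst-rename ρ σ (fst t)     = cong fst (subst-rename ρ σ t)
subst-rename ρ σ (snd t)     = cong snd (subst-rename ρ σ t)
subst-rename ρ σ zer         = refl
subst-rename ρ σ (suc' t)    = cong suc' (subst-rename ρ σ t)
subst-rename ρ σ tt          = refl
subst-rename ρ σ ff          = refl
subst-rename ρ σ (if b t u)  = cong₃ if (subst-rename ρ σ b) (subst-rename ρ σ t) (subst-rename ρ σ u)
subst-rename ρ σ (rec z s n) = cong₃ rec (subst-rename ρ σ z) (subst-rename ρ σ s) (subst-rename ρ σ n)

rename-rename : ∀ {Γ Δ Θ A} (ρ : Ren Γ Δ) (ρ′ : Ren Δ Θ) (t : Tm Γ A) →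
                rename ρ′ (rename ρ t) ≡ rename (ρ′ ∘ ρ) t
rename-rename ρ ρ′ t = trans (rename-as-subst ρ′ (rename ρ t))
                      (trans (subst-rename ρ (var ∘ ρ′) t) (sym (rename-as-subst (ρ′ ∘ ρ) t)))

rename-subst : ∀ {Γ Δ Θ A} (σ : Sub Γ Δ) (ρ : Ren Δ Θ) (t : Tm Γ A) →
               rename ρ (subst σ t) ≡ subst (rename ρ ∘ σ) t
rename-subst σ ρ (var x)     = refl
rename-subst σ ρ (lam t)     = cong lam (trans (rename-subst (exts σ) (ext ρ) t) (subst-cong e t))
  where
  e : rename (ext ρ) ∘ exts σ ≗ˢ exts (rename ρ ∘ σ)
  e here      = refl
  e (there x) = trans (rename-rename there (ext ρ) (σ x)) (sym (rename-rename ρ there (σ x)))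
rename-subst σ ρ (t · u)     = cong₂ _·_ (rename-subst σ ρ t) (rename-subst σ ρ u)
rename-subst σ ρ (pair t u)  = cong₂ pair (rename-subst σ ρ t) (rename-subst σ ρ u)
rename-subst σ ρ (fst t)     = cong fst (rename-subst σ ρ t)
rename-subst σ ρ (snd t)     = cong snd (rename-subst σ ρ t)
rename-subst σ ρ zer         = refl
rename-subst σ ρ (suc' t)    = cong suc' (rename-subst σ ρ t)
rename-subst σ ρ tt          = refl
rename-subst σ ρ ff          = refl
rename-subst σ ρ (if b t u)  = cong₃ if (rename-subst σ ρ b) (rename-subst σ ρ t) (rename-subst σ ρ u)
rename-subst σ ρ (rec z s n) = cong₃ rec (rename-subst σ ρ z) (rename-subst σ ρ s) (rename-subst σ ρ n)

subst-subst : ∀ {Γ Δ Θ A} (σ : Sub Γ Δ) (τ : Sub Δ Θ) (t : Tm Γ A) →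
              subst τ (subst σ t) ≡ subst (subst τ ∘ σ) t
subst-subst σ τ (var x)     = refl
subst-subst σ τ (lam t)     = cong lam (trans (subst-subst (exts σ) (exts τ) t) (subst-cong e t))
  where
  e : subst (exts τ) ∘ exts σ ≗ˢ exts (subst τ ∘ σ)
  e here      = refl
  e (there x) = trans (subst-rename there (exts τ) (σ x)) (sym (rename-subst τ there (σ x)))
subst-subst σ τ (t · u)     = cong₂ _·_ (subst-subst σ τ t) (subst-subst σ τ u)
subst-subst σ τ (pair t u)  = cong₂ pair (subst-subst σ τ t) (subst-subst σ τ u)
subst-subst σ τ (fst t)     = cong fst (subst-subst σ τ t)
subst-subst σ τ (snd t)     = cong snd (subst-subst σ τ t)
subst-subst σ τ zer         = refl
subst-subst σ τ (suc' t)    = cong suc' (subst-subst σ τ t)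
subst-subst σ τ tt          = refl
subst-subst σ τ ff          = refl
subst-subst σ τ (if b t u)  = cong₃ if (subst-subst σ τ b) (subst-subst σ τ t) (subst-subst σ τ u)
subst-subst σ τ (rec z s n) = cong₃ rec (subst-subst σ τ z) (subst-subst σ τ s) (subst-subst σ τ n)

subst-var : ∀ {Γ A} (t : Tm Γ A) → subst var t ≡ t
subst-var (var x)     = refl
subst-var (lam t)     = cong lam (trans (subst-cong (λ { here → refl ; (there x) → refl }) t) (subst-var t))
subst-var (t · u)     = cong₂ _·_ (subst-var t) (subst-var u)
subst-var (pair t u)  = cong₂ pair (subst-var t) (subst-var u)
subst-var (fst t)     = cong fst (subst-var t)
subst-var (snd t)     = cong snd (subst-var t)
subst-var zer         = refl
subst-var (suc' t)    = cong suc' (subst-var t)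
subst-var tt          = refl
subst-var ff          = refl
subst-var (if b t u)  = cong₃ if (subst-var b) (subst-var t) (subst-var u)
subst-var (rec z s n) = cong₃ rec (subst-var z) (subst-var s) (subst-var n)

infixr 5 _∷ˢ_

_∷ˢ_ : ∀ {Γ A} → Closed A → Sub Γ [] → Sub (A ∷ Γ) []
(u ∷ˢ σ) here      = u
(u ∷ˢ σ) (there x) = σ x

subst-exts-[] : ∀ {Γ A B} (σ : Sub Γ []) (u : Closed A) (t : Tm (A ∷ Γ) B) →
                subst (exts σ) t [ u ] ≡ subst (u ∷ˢ σ) t
subst-exts-[] σ u t = trans (subst-subst (exts σ) (sub0 u) t) (subst-cong e t)
  where
  e : subst (sub0 u) ∘ exts σ ≗ˢ u ∷ˢ σ
  e here      = refl
  e (there x) = trans (subst-rename there (sub0 u) (σ x)) (subst-var (σ x))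

module Semantics (Q : Set) where

  ⟦_⟧ᵗ : Ty → Set
  ⟦ nat ⟧ᵗ   = Dialogue Q ℕ
  ⟦ bool ⟧ᵗ  = Dialogue Q Bool
  ⟦ A ⇒ B ⟧ᵗ = ⟦ A ⟧ᵗ → ⟦ B ⟧ᵗ
  ⟦ A ⊗ B ⟧ᵗ = ⟦ A ⟧ᵗ × ⟦ B ⟧ᵗ

  extend : ∀ A {X : Set} → (X → ⟦ A ⟧ᵗ) → Dialogue Q X → ⟦ A ⟧ᵗ
  extend nat     g d = d >>= g
  extend bool    g d = d >>= g
  extend (A ⇒ B) g d = λ x → extend B (λ y → g y x) d
  extend (A ⊗ B) g d = extend A (proj₁ ∘′ g) d , extend B (proj₂ ∘′ g) d

  Env : Ctx → Set
  Env Γ = ∀ {A} → Γ ∋ A → ⟦ A ⟧ᵗ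

  ∅ : Env []
  ∅ ()

  _▸_ : ∀ {Γ A} → Env Γ → ⟦ A ⟧ᵗ → Env (A ∷ Γ)
  (γ ▸ x) here      = x
  (γ ▸ x) (there v) = γ v

  iterate : ∀ {A} → ⟦ A ⟧ᵗ → ⟦ nat ⇒ A ⇒ A ⟧ᵗ → ℕ → ⟦ A ⟧ᵗ
  iterate z s zero    = z
  iterate z s (suc m) = s (leaf m) (iterate z s m)

  ⟦_⟧ : ∀ {Γ A} → Tm Γ A → Env Γ → ⟦ A ⟧ᵗ
  ⟦ var x ⟧         γ = γ x
  ⟦ lam t ⟧         γ = λ x → ⟦ t ⟧ (γ ▸ x)
  ⟦ t · u ⟧         γ = ⟦ t ⟧ γ (⟦ u ⟧ γ)
  ⟦ pair t u ⟧      γ = ⟦ t ⟧ γ , ⟦ u ⟧ γ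
  ⟦ fst t ⟧         γ = proj₁ (⟦ t ⟧ γ)
  ⟦ snd t ⟧         γ = proj₂ (⟦ t ⟧ γ)
  ⟦ zer ⟧           γ = leaf zero
  ⟦ suc' t ⟧        γ = ⟦ t ⟧ γ >>= λ n → leaf (suc n)
  ⟦ tt ⟧            γ = leaf true
  ⟦ ff ⟧            γ = leaf false
  ⟦ if {A} b t u ⟧  γ = extend A (λ c → if c then ⟦ t ⟧ γ else ⟦ u ⟧ γ) (⟦ b ⟧ γ)
  ⟦ rec {A} z s n ⟧ γ = extend A (iterate (⟦ z ⟧ γ) (⟦ s ⟧ γ)) (⟦ n ⟧ γ)

  module Tracking (α : Q → ℕ) where

    boolTm : Bool → Closed bool
    boolTm true  = tt
    boolTm false = ff

    Tracks : ∀ A → Closed A → ⟦ A ⟧ᵗ → Set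
    Tracks nat     t d = t ≈ num (eval α d)
    Tracks bool    t d = t ≈ boolTm (eval α d)
    Tracks (A ⇒ B) t f = ∀ u x → Tracks A u x → Tracks B (t · u) (f x)
    Tracks (A ⊗ B) t p = Tracks A (fst t) (proj₁ p) × Tracks B (snd t) (proj₂ p)

    tracks-≈ : ∀ A {t t′ x} → t ≈ t′ → Tracks A t x → Tracks A t′ x
    tracks-≈ nat     t≈t′ r         = ≈trans (≈sym t≈t′) r
    tracks-≈ bool    t≈t′ r         = ≈trans (≈sym t≈t′) r
    tracks-≈ (A ⇒ B) t≈t′ r         = λ u x ru → tracks-≈ B (app-cong t≈t′ ≈refl) (r u x ru)
    tracks-≈ (A ⊗ B) t≈t′ (r₁ , r₂) =
      tracks-≈ A (fst-cong t≈t′) r₁ , tracks-≈ B (snd-cong t≈t′) r₂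

    tracks-extend : ∀ A {X : Set} (g : X → ⟦ A ⟧ᵗ) d t →
                    Tracks A t (g (eval α d)) → Tracks A t (extend A g d)
    tracks-extend nat     g d t r rewrite eval->>= α d g = r
    tracks-extend bool    g d t r rewrite eval->>= α d g = r
    tracks-extend (A ⇒ B) g d t r = λ u x ru → tracks-extend B (λ y → g y x) d (t · u) (r u x ru)
    tracks-extend (A ⊗ B) g d t (r₁ , r₂) =
      tracks-extend A (proj₁ ∘′ g) d (fst t) r₁ , tracks-extend B (proj₂ ∘′ g) d (snd t) r₂

    tracks-rec : ∀ A {z s zs ss} → Tracks A z zs → Tracks (nat ⇒ A ⇒ A) s ss →
                 ∀ m → Tracks A (rec z s (num m)) (iterate zs ss m)
    tracks-rec A {z} {s} rz rs zero    = tracks-≈ A (≈sym (β-rec-0 z s)) rz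
    tracks-rec A {z} {s} rz rs (suc m) =
      tracks-≈ A (≈sym (β-rec-S z s (num m))) (rs (num m) (leaf m) ≈refl _ _ (tracks-rec A rz rs m))

    fundamental : ∀ {Γ A} (t : Tm Γ A) (σ : Sub Γ []) (γ : Env Γ) →
                  (∀ {B} (x : Γ ∋ B) → Tracks B (σ x) (γ x)) → Tracks A (subst σ t) (⟦ t ⟧ γ)
    fundamental (var x) σ γ r = r x
    fundamental {A = A ⇒ B} (lam t) σ γ r u x ru =
      tracks-≈ B (≈sym (≈trans (β-lam _ u) (≡⇒≈ (subst-exts-[] σ u t))))
        (fundamental t (u ∷ˢ σ) (γ ▸ x) λ { here → ru ; (there y) → r y })
    fundamental (t · u) σ γ r = fundamental t σ γ r (subst σ u) (⟦ u ⟧ γ) (fundamental u σ γ r)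
    fundamental {A = A ⊗ B} (pair t u) σ γ r =
      tracks-≈ A (≈sym (β-fst _ _)) (fundamental t σ γ r) ,
      tracks-≈ B (≈sym (β-snd _ _)) (fundamental u σ γ r)
    fundamental (fst t) σ γ r = proj₁ (fundamental t σ γ r)
    fundamental (snd t) σ γ r = proj₂ (fundamental t σ γ r)
    fundamental zer σ γ r = ≈refl
    fundamental (suc' t) σ γ r rewrite eval->>= α (⟦ t ⟧ γ) (λ n → leaf (suc n)) =
      suc-cong (fundamental t σ γ r)
    fundamental tt σ γ r = ≈refl
    fundamental ff σ γ r = ≈refl
    fundamental {A = A} (if b t u) σ γ r =
      tracks-extend A _ (⟦ b ⟧ γ) _ (branch (eval α (⟦ b ⟧ γ)) (fundamental b σ γ r))
      where
      branch : ∀ c → subst σ b ≈ boolTm c →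
               Tracks A (if (subst σ b) (subst σ t) (subst σ u)) (if c then ⟦ t ⟧ γ else ⟦ u ⟧ γ)
      branch true  b≈ =
        tracks-≈ A (≈sym (≈trans (if-cong b≈ ≈refl ≈refl) (β-if-tt _ _))) (fundamental t σ γ r)
      branch false b≈ =
        tracks-≈ A (≈sym (≈trans (if-cong b≈ ≈refl ≈refl) (β-if-ff _ _))) (fundamental u σ γ r)
    fundamental {A = A} (rec z s n) σ γ r =
      tracks-extend A _ (⟦ n ⟧ γ) _
        (tracks-≈ A (rec-cong ≈refl ≈refl (≈sym (fundamental n σ γ r)))
          (tracks-rec A (fundamental z σ γ r) (fundamental s σ γ r) (eval α (⟦ n ⟧ γ))))

    fundamental-closed : ∀ {A} (t : Closed A) → Tracks A t (⟦ t ⟧ ∅)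
    fundamental-closed {A} t =
      substEq (λ t′ → Tracks A t′ (⟦ t ⟧ ∅)) (subst-var t) (fundamental t var ∅ λ ())

isZeroᵀ : ∀ {Γ} → Tm Γ (nat ⇒ bool)
isZeroᵀ = lam (rec tt (lam (lam ff)) (var here))

-- equalsᵀ (S p) (S q) = equalsᵀ p q, the recursive call being the variable of index 3.
equalsᵀ : ∀ {Γ} → Tm Γ (nat ⇒ nat ⇒ bool)
equalsᵀ = lam (rec isZeroᵀ
                   (lam (lam (lam (rec ff (lam (lam (var (there (there (there here))) · var (there here))))
                                         (var here)))))
                   (var here))

-- overrideᵀ n m f x = if equalsᵀ x n then m else f x
overrideᵀ : ∀ {Γ} → Tm Γ (nat ⇒ nat ⇒ (nat ⇒ nat) ⇒ nat ⇒ nat)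
overrideᵀ = lam (lam (lam (lam (if (equalsᵀ · var here · var (there (there (there here))))
                                   (var (there (there here)))
                                   (var (there here) · var here)))))

mapTm : FinMap → Closed (nat ⇒ nat)
mapTm []            = lam zer
mapTm ((n , m) ∷ f) = overrideᵀ · num n · num m · mapTm f

mapTm-correct : ∀ f x → mapTm f · num x ≈ num (lookup f x)
mapTm-correct f x = ≈trans (fundamental-closed (mapTm f) (num x) (leaf x) ≈refl)
                           (≡⇒≈ (cong (num ∘ eval (λ ())) (mapTm-sem f)))
  where
  open Semantics ⊥
  open Tracking (λ ())

  num-sem : ∀ {Γ} (γ : Env Γ) n → ⟦ num n ⟧ γ ≡ leaf n
  num-sem γ zero    = refl
  num-sem γ (suc n) rewrite num-sem γ n = refl

  equalsᵀ-sem : ∀ {Γ} (γ : Env Γ) x y → ⟦ equalsᵀ ⟧ γ (leaf x) (leaf y) ≡ leaf (x ≡ᵇ y)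
  equalsᵀ-sem γ zero    zero    = refl
  equalsᵀ-sem γ zero    (suc y) = refl
  equalsᵀ-sem γ (suc x) zero    = refl
  equalsᵀ-sem γ (suc x) (suc y) = equalsᵀ-sem γ x y

  mapTm-sem : ∀ f → ⟦ mapTm f ⟧ ∅ (leaf x) ≡ leaf (lookup f x)
  mapTm-sem []            = refl
  mapTm-sem ((n , m) ∷ f)
    rewrite num-sem ∅ n | num-sem ∅ m | equalsᵀ-sem ∅ x n with x ≡ᵇ n
  ... | true  = refl
  ... | false = mapTm-sem f

-- unpair enumerates ℕ × ℕ along the diagonals, in the order counted by cantor.
unpair : ℕ → ℕ × ℕ
unpair zero = 0 , 0
unpair (suc v) with unpair v
... | zero  , b = suc b , 0
... | suc a , b = a , suc b

cantor-next-diagonal : ∀ b → cantor (suc b) 0 ≡ suc (cantor 0 b)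
cantor-next-diagonal b = begin
  tri (suc b + 0) + 0 ≡⟨ +-identityʳ _ ⟩
  tri (suc b + 0)     ≡⟨ cong tri (+-identityʳ (suc b)) ⟩
  suc b + tri b       ≡⟨ cong suc (+-comm b (tri b)) ⟩
  suc (tri b + b)     ∎
  where open ≡-Reasoning

cantor-along-diagonal : ∀ a b → cantor a (suc b) ≡ suc (cantor (suc a) b)
cantor-along-diagonal a b = begin
  tri (a + suc b) + suc b       ≡⟨ cong (λ s → tri s + suc b) (+-suc a b) ⟩
  tri (suc (a + b)) + suc b     ≡⟨ +-suc _ b ⟩
  suc (tri (suc (a + b)) + b)   ∎
  where open ≡-Reasoning

cantor-unpair : ∀ v → uncurry cantor (unpair v) ≡ v
cantor-unpair zero = refl
cantor-unpair (suc v) with unpair v | cantor-unpair v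
... | zero  , b | e = trans (cantor-next-diagonal b) (cong suc e)
... | suc a , b | e = trans (cantor-along-diagonal a b) (cong suc e)

triple : ℕ → ℕ × ℕ × ℕ
triple v = let i , w = unpair v in i , unpair w

code-triple : ∀ v → code (just (triple v)) ≡ suc v
code-triple v = let i , w = unpair v in
  cong suc (trans (cong (cantor i) (cantor-unpair w)) (cantor-unpair v))

module Decoding (k : ℕ) where

  decodeTriple : ℕ × ℕ × ℕ → Outcome ⊤ k
  decodeTriple (zero , _) = exit _
  decodeTriple (suc i , n , m) with i <? k
  ... | yes i<k = update (fromℕ< i<k) n m
  ... | no  _   = exit _

  decode : ℕ → Outcome ⊤ k
  decode zero    = exit _
  decode (suc v) = decodeTriple (triple v)

  decodeTriple-update : ∀ t {i n m} → decodeTriple t ≡ update i n m → t ≡ (suc (toℕ i) , n , m)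
  decodeTriple-update (suc i , n , m) e with i <? k
  decodeTriple-update (suc i , n , m) refl | yes i<k rewrite toℕ-fromℕ< i<k = refl

  decodeTriple-exit : ∀ i n m → decodeTriple (i , n , m) ≡ exit _ → ¬ (1 ≤ i × i ≤ k)
  decodeTriple-exit zero n m _ (() , _)
  decodeTriple-exit (suc i) n m e with i <? k
  decodeTriple-exit (suc i) n m () | yes _
  ... | no i≮k = λ (_ , i<k) → i≮k i<k

  decode-update : ∀ v {i n m} → decode v ≡ update i n m → v ≡ code (just (suc (toℕ i) , n , m))
  decode-update (suc v) e =
    trans (sym (code-triple v)) (cong (code ∘ just) (decodeTriple-update (triple v) e))

  InvalidCode : ℕ → Set
  InvalidCode v = ∃[ i ] ∃[ n ] ∃[ m ] v ≡ code (just (i , n , m)) × ¬ (1 ≤ i × i ≤ k)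

  decode-exit : ∀ v → decode v ≡ exit _ → v ≡ code nothing ⊎ InvalidCode v
  decode-exit zero    _ = inj₁ refl
  decode-exit (suc v) e =
    let i , n , m = triple v in inj₂ (i , n , m , sym (code-triple v) , decodeTriple-exit i n m e)

trivialEnvironment : Environment
trivialEnvironment = record { Query = ⊥ ; Oracle = ⊤ ; answer = λ _ () }

module Interpretation (k : ℕ) where

  Q : Set
  Q = Query trivialEnvironment ⊎ (Fin k × ℕ)

  open Semantics Q
  open Decoding k

  answerMaps : (Fin k → FinMap) → Q → ℕ
  answerMaps = answerK trivialEnvironment _

  generic : Fin k → ⟦ nat ⇒ nat ⟧ᵗ
  generic i d = d >>= λ x → ask (inj₂ (i , x)) leaf

  applyAllᵗ : ∀ j → ⟦ Arr j nat ⟧ᵗ → (Fin j → ⟦ nat ⇒ nat ⟧ᵗ) → ⟦ nat ⟧ᵗ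
  applyAllᵗ zero    x g = x
  applyAllᵗ (suc j) x g = applyAllᵗ j (x (g zero)) (g ∘ suc)

  module _ (β : Fin k → FinMap) where

    open Tracking (answerMaps β)

    tracks-generic : ∀ i → Tracks (nat ⇒ nat) (mapTm (β i)) (generic i)
    tracks-generic i u d u≈d rewrite eval->>= (answerMaps β) d (λ x → ask (inj₂ (i , x)) leaf) =
      ≈trans (app-cong ≈refl u≈d) (mapTm-correct (β i) _)

    tracks-applyAll : ∀ j {t x} (f : Fin j → Closed (nat ⇒ nat)) {g} → Tracks (Arr j nat) t x →
                      (∀ i → Tracks (nat ⇒ nat) (f i) (g i)) →
                      Tracks nat (applyAll j t f) (applyAllᵗ j x g)
    tracks-applyAll zero    f rt rf = rt
    tracks-applyAll (suc j) f rt rf = tracks-applyAll j (f ∘ suc) (rt (f zero) _ (rf zero)) (rf ∘ suc)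

  module _ (U : Closed (Arr k nat)) where

    dialogueOf : Dialogue Q ℕ
    dialogueOf = applyAllᵗ k (⟦ U ⟧ ∅) generic

    applyAll-mapTm : ∀ β → applyAll k U (mapTm ∘ β) ≈ num (eval (answerMaps β) dialogueOf)
    applyAll-mapTm β =
      tracks-applyAll β k (mapTm ∘ β) (Tracking.fundamental-closed (answerMaps β) U) (tracks-generic β)

    decoded : Dialogue Q (Outcome ⊤ k)
    decoded = relabel id decode dialogueOf

    applyAll-decoded : ∀ β {r} → eval (answerMaps β) decoded ≡ r →
                       ∃[ v ] applyAll k U (mapTm ∘ β) ≈ num v × decode v ≡ r
    applyAll-decoded β e = _ , applyAll-mapTm β , trans (sym (eval-relabel (λ _ → refl) dialogueOf)) e

    module _ (isU : IsTypedUpdateProcedure k U) where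

      open IsTypedUpdateProcedure isU

      decoded-isUpdate : IsUpdateTree trivialEnvironment k decoded
      decoded-isUpdate _ β β′ i {n} {m} agree e₁ β′[i][n]≡m e₂
        with applyAll-decoded β e₁ | applyAll-decoded β′ e₂
      ... | v , U≈v , dv | v′ , U≈v′ , dv′ =
        cond2 (mapTm ∘ β) (mapTm ∘ β′) i n m _ _
          (λ j j<i → ≡⇒≈ (cong mapTm (agree j j<i)))
          (≈trans U≈v (≡⇒≈ (cong num (decode-update v dv))))
          (≈trans (mapTm-correct (β′ i) n) (≡⇒≈ (cong num β′[i][n]≡m)))
          (≈trans U≈v′ (≡⇒≈ (cong num (decode-update v′ dv′))))

      exit-emptyCode : ∀ β → eval (answerMaps β) decoded ≡ exit _ →
                       applyAll k U (mapTm ∘ β) ≈ num (code nothing)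
      exit-emptyCode β e with applyAll-decoded β e
      ... | v , U≈v , dv with decode-exit v dv
      ...   | inj₁ v≡0 = ≈trans U≈v (≡⇒≈ (cong num v≡0))
      ...   | inj₂ (i , n , m , v≡code , out-of-range) =
        ⊥-elim (out-of-range (cond1 (mapTm ∘ β) i n m (≈trans U≈v (≡⇒≈ (cong num v≡code)))))

mainTheorem14 : (k : ℕ) → 1 ≤ k → (U : Closed (Arr k nat)) →
    IsTypedUpdateProcedure k U →
    Σ (Fin k → Closed (nat ⇒ nat)) (λ ε → applyAll k U ε ≈ num (code nothing))
mainTheorem14 k _ U isU =
  let _ , resolves = solve k trivialEnvironment _ (decoded U) (decoded-isUpdate U isU)
      β , exits    = resolves _
  in  mapTm ∘ β , exit-emptyCode U isU β exits
  where open Interpretation k
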